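{- Let $\Sigma$ be a signature and $\mathbf{K}$ a class of $\Sigma$-structures that is closed under subalgebras and isomorphisms. Then there is a functor $Co_{\mathbf{K}}:\Sigma\text{ -Str}^{op}\to Ord$ associating to a $\Sigma$-structure $A$ the set of congruences $\theta$ on $A$ such that $A/\theta\in\mathbf{K}$ (ordered by inclusion), and to a homomorphism $f:A\to B$ the function $$Co_{\mathbf{K}}(f):Co_{\mathbf{K}}(B)\to Co_{\mathbf{K}}(A),\quad\theta\mapsto(f\times f)^{ -1}(\theta)=\{\langle a,a'\rangle\mid\langle f(a),f(a')\rangle\in\theta\}.$$ Conversely, if $\mathbf{K}$ is a class of $\Sigma$-structures such that $Co_{\mathbf{K}}:\Sigma\text{ -Str}^{op}\to Ord$, $A\mapsto\{\theta\text{ congruence on }A\mid A/\theta\in\mathbf{K}\}$, is a functor which on morphisms is given by $Co_{\mathbf{K}}(f)=(f\times f)^{ -1}$, then $\mathbf{K}$ is closed under substructures.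
   Context: $\Sigma$-Str is the category of $\Sigma$-structures (algebras for a signature $\Sigma$ of finitary function symbols) and homomorphisms. $Ord$ is the category of partially ordered sets and order preserving maps. -}

module Defs where

open import Level using (Level; _⊔_; suc)
open import Data.Fin.Base using (Fin)
open import Data.Nat.Base using (ℕ)
open import Data.Product.Base using (Σ; _×_; _,_; proj₁; proj₂; swap)
open import Data.Vec.Functional using (Vector)
open import Function.Base using (id; _∘_; _on_)
open import Relation.Binary.Bundles using (Setoid; Poset)
open import Relation.Binary.Core using (Rel; _⇒_; _⇔_)
open import Relation.Binary.Structures using (IsEquivalence)
open import Relation.Binary.Morphism.Bundles using (PosetHomomorphism)
import Relation.Binary.Construct.On as On
import Relation.Binary.Morphism.Construct.Composition as Composition
import Relation.Binary.Morphism.Construct.Identity as Identity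
open import Relation.Unary using (Pred; _∈_)

private
  variable
    o h e o′ h′ e′ : Level

------------------------------------------------------------------------
-- Categories (with an equivalence relation on each hom-type)

record Category (o h e : Level) : Set (suc (o ⊔ h ⊔ e)) where
  infix  4 _≈_
  infixr 9 _⊚_
  field
    Obj       : Set o
    Hom       : Obj → Obj → Set h
    _≈_       : ∀ {A B} → Rel (Hom A B) e
    idn       : ∀ {A} → Hom A A
    _⊚_       : ∀ {A B C} → Hom B C → Hom A B → Hom A C
    equiv     : ∀ {A B} → IsEquivalence (_≈_ {A} {B})
    ⊚-cong    : ∀ {A B C} {f f′ : Hom B C} {g g′ : Hom A B} →
                f ≈ f′ → g ≈ g′ → f ⊚ g ≈ f′ ⊚ g′
    assoc     : ∀ {A B C D} {f : Hom C D} {g : Hom B C} {h : Hom A B} →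
                (f ⊚ g) ⊚ h ≈ f ⊚ (g ⊚ h)
    identityˡ : ∀ {A B} {f : Hom A B} → idn ⊚ f ≈ f
    identityʳ : ∀ {A B} {f : Hom A B} → f ⊚ idn ≈ f

  record _≅_ (A B : Obj) : Set (h ⊔ e) where
    field
      to      : Hom A B
      from    : Hom B A
      to∘from : to ⊚ from ≈ idn
      from∘to : from ⊚ to ≈ idn

_ᵒᵖ : Category o h e → Category o h e
C ᵒᵖ = record
  { Obj       = Obj
  ; Hom       = λ A B → Hom B A
  ; _≈_       = _≈_
  ; idn       = idn
  ; _⊚_       = λ f g → g ⊚ f
  ; equiv     = equiv
  ; ⊚-cong    = λ p q → ⊚-cong q p
  ; assoc     = IsEquivalence.sym equiv assoc
  ; identityˡ = identityʳ
  ; identityʳ = identityˡ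
  }
  where open Category C

module _ (C : Category o h e) (D : Category o′ h′ e′) where
  private
    module C = Category C
    module D = Category D

  record IsFunctor (F₀ : C.Obj → D.Obj)
                   (F₁ : ∀ {A B} → C.Hom A B → D.Hom (F₀ A) (F₀ B))
                   : Set (o ⊔ h ⊔ e ⊔ e′) where
    field
      resp-≈       : ∀ {A B} {f g : C.Hom A B} → f C.≈ g → F₁ f D.≈ F₁ g
      identity     : ∀ {A} → F₁ (C.idn {A}) D.≈ D.idn
      homomorphism : ∀ {A B C} {g : C.Hom B C} {f : C.Hom A B} →
                     F₁ (g C.⊚ f) D.≈ F₁ g D.⊚ F₁ f

Ord : (c ℓ₁ ℓ₂ : Level) → Category (suc (c ⊔ ℓ₁ ⊔ ℓ₂)) (c ⊔ ℓ₁ ⊔ ℓ₂) (c ⊔ ℓ₁)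
Ord c ℓ₁ ℓ₂ = record
  { Obj       = Poset c ℓ₁ ℓ₂
  ; Hom       = PosetHomomorphism
  ; _≈_       = λ {P} {Q} f g → ∀ x → Poset._≈_ Q (⟦ f ⟧ x) (⟦ g ⟧ x)
  ; idn       = λ {P} → Identity.posetHomomorphism P
  ; _⊚_       = λ g f → Composition.posetHomomorphism f g
  ; equiv     = λ {P} {Q} → record
    { refl  = λ _ → Poset.Eq.refl Q
    ; sym   = λ p x → Poset.Eq.sym Q (p x)
    ; trans = λ p q x → Poset.Eq.trans Q (p x) (q x)
    }
  ; ⊚-cong    = λ {P} {Q} {R} {f} {f′} {g} {g′} p q x →
                Poset.Eq.trans R (cong f (q x)) (p (⟦ g′ ⟧ x))
  ; assoc     = λ {P} {Q} {R} {S} _ → Poset.Eq.refl S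
  ; identityˡ = λ {P} {Q} _ → Poset.Eq.refl Q
  ; identityʳ = λ {P} {Q} _ → Poset.Eq.refl Q
  }
  where open PosetHomomorphism

------------------------------------------------------------------------
-- Σ-structures.  Sets are setoids, so that A / θ can be formed by
-- taking θ as the new equality on the carrier of A.

record Signature (s : Level) : Set (suc s) where
  field
    Op    : Set s
    arity : Op → ℕ

module _ {s : Level} (𝕊 : Signature s) where
  open Signature 𝕊

  record Structure (ℓ : Level) : Set (s ⊔ suc ℓ) where
    field
      setoid : Setoid ℓ ℓ
    open Setoid setoid public
    field
      interp      : ∀ σ → Vector Carrier (arity σ) → Carrier
      interp-cong : ∀ σ {xs ys : Vector Carrier (arity σ)} →
                    (∀ i → xs i ≈ ys i) → interp σ xs ≈ interp σ ys

module _ {s : Level} {𝕊 : Signature s} where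
  open Signature 𝕊

  record Homomorphism {ℓ : Level} (A B : Structure 𝕊 ℓ) : Set (s ⊔ ℓ) where
    private
      module A = Structure A
      module B = Structure B
    field
      ⟦_⟧      : A.Carrier → B.Carrier
      cong     : ∀ {x y} → x A.≈ y → ⟦ x ⟧ B.≈ ⟦ y ⟧
      preserve : ∀ σ xs → ⟦ A.interp σ xs ⟧ B.≈ B.interp σ (⟦_⟧ ∘ xs)

  module _ {ℓ : Level} (A : Structure 𝕊 ℓ) where
    open Structure A

    record Subalgebra : Set (s ⊔ suc ℓ) where
      field
        member        : Pred Carrier ℓ
        member-resp   : ∀ {x y} → x ≈ y → x ∈ member → y ∈ member
        member-interp : ∀ σ xs → (∀ i → xs i ∈ member) → interp σ xs ∈ member

    record Congruence : Set (s ⊔ suc ℓ) where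
      field
        rel           : Rel Carrier ℓ
        isEquivalence : IsEquivalence rel
        -- makes rel a well-defined relation on the setoid A
        ≈⇒rel         : _≈_ ⇒ rel
        compatible    : ∀ σ {xs ys} → (∀ i → rel (xs i) (ys i)) →
                        rel (interp σ xs) (interp σ ys)

  subalgebra : ∀ {ℓ} (A : Structure 𝕊 ℓ) → Subalgebra A → Structure 𝕊 ℓ
  subalgebra A S = record
    { setoid      = record
      { Carrier       = Σ A.Carrier S.member
      ; _≈_           = A._≈_ on proj₁
      ; isEquivalence = On.isEquivalence proj₁ A.isEquivalence
      }
    ; interp      = λ σ xs → A.interp σ (proj₁ ∘ xs)
                           , S.member-interp σ (proj₁ ∘ xs) (proj₂ ∘ xs)
    ; interp-cong = λ σ → A.interp-cong σ
    }
    where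
    module A = Structure A
    module S = Subalgebra S

  infix 7 _/_

  _/_ : ∀ {ℓ} (A : Structure 𝕊 ℓ) → Congruence A → Structure 𝕊 ℓ
  A / θ = record
    { setoid      = record { isEquivalence = Congruence.isEquivalence θ }
    ; interp      = Structure.interp A
    ; interp-cong = Congruence.compatible θ
    }

module _ {s : Level} (𝕊 : Signature s) (ℓ : Level) where

  Str : Category (s ⊔ suc ℓ) (s ⊔ ℓ) ℓ
  Str = record
    { Obj       = Structure 𝕊 ℓ
    ; Hom       = Homomorphism
    ; _≈_       = λ {A} {B} f g → ∀ x → Structure._≈_ B (⟦ f ⟧ x) (⟦ g ⟧ x)
    ; idn       = λ {A} → record
      { ⟦_⟧      = id
      ; cong     = id
      ; preserve = λ _ _ → Structure.refl A
      }
    ; _⊚_       = λ {A} {B} {C} g f → record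
      { ⟦_⟧      = ⟦ g ⟧ ∘ ⟦ f ⟧
      ; cong     = cong g ∘ cong f
      ; preserve = λ σ xs → Structure.trans C (cong g (preserve f σ xs))
                                              (preserve g σ (⟦ f ⟧ ∘ xs))
      }
    ; equiv     = λ {A} {B} → record
      { refl  = λ _ → Structure.refl B
      ; sym   = λ p x → Structure.sym B (p x)
      ; trans = λ p q x → Structure.trans B (p x) (q x)
      }
    ; ⊚-cong    = λ {A} {B} {C} {f} {f′} {g} {g′} p q x →
                  Structure.trans C (cong f (q x)) (p (⟦ g′ ⟧ x))
    ; assoc     = λ {A} {B} {C} {D} _ → Structure.refl D
    ; identityˡ = λ {A} {B} _ → Structure.refl B
    ; identityʳ = λ {A} {B} _ → Structure.refl B
    }
    where open Homomorphism

  -- Two congruences with the same pairs are the same congruence, although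
  -- they may be different terms.  A class of structures must not tell the
  -- two quotients apart: this is extensionality of sets, and it is much
  -- weaker than closure under isomorphism.
  record Class (k : Level) : Set (s ⊔ suc ℓ ⊔ suc k) where
    field
      contains    : Pred (Structure 𝕊 ℓ) k
      extensional : ∀ (A : Structure 𝕊 ℓ) (θ ψ : Congruence A) →
                    Congruence.rel θ ⇔ Congruence.rel ψ →
                    A / θ ∈ contains → A / ψ ∈ contains

module _ {s ℓ k : Level} {𝕊 : Signature s} (𝐊 : Class 𝕊 ℓ k) where
  open Class 𝐊
  open Congruence using (rel)

  ClosedUnderSubalgebras : Set (s ⊔ suc ℓ ⊔ k)
  ClosedUnderSubalgebras =
    ∀ A → A ∈ contains → (S : Subalgebra A) → subalgebra A S ∈ contains

  ClosedUnderIsomorphisms : Set (s ⊔ suc ℓ ⊔ k)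
  ClosedUnderIsomorphisms = ∀ A B → A ≅ B → A ∈ contains → B ∈ contains
    where open Category (Str 𝕊 ℓ) using (_≅_)

  Co : Structure 𝕊 ℓ → Poset (s ⊔ suc ℓ ⊔ k) ℓ ℓ
  Co A = record
    { Carrier        = Σ (Congruence A) λ θ → A / θ ∈ contains
    ; _≈_            = λ (θ , _) (ψ , _) → rel θ ⇔ rel ψ
    ; _≤_            = λ (θ , _) (ψ , _) → rel θ ⇒ rel ψ
    ; isPartialOrder = record
      { isPreorder = record
        { isEquivalence = record
          { refl  = id , id
          ; sym   = swap
          ; trans = λ (p , p′) (q , q′) → (λ x → q (p x)) , (λ x → p′ (q′ x))
          }
        ; reflexive = proj₁
        ; trans     = λ p q x → q (p x)
        }
      ; antisym = _,_
      }
    }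

  -- Functoriality of A ↦ Co A, f ↦ (f × f)⁻¹.  That (f × f)⁻¹ maps
  -- Co B into Co A is part of the assertion, hence the field Co₁.
  record CoIsFunctor : Set (s ⊔ suc ℓ ⊔ k) where
    field
      Co₁          : ∀ {A B} → Homomorphism A B → PosetHomomorphism (Co B) (Co A)
      Co₁-preimage : ∀ {A B} (f : Homomorphism A B) (θ : Poset.Carrier (Co B)) →
                     rel (proj₁ (PosetHomomorphism.⟦_⟧ (Co₁ f) θ))
                       ⇔ (rel (proj₁ θ) on Homomorphism.⟦_⟧ f)
      isFunctor    : IsFunctor (Str 𝕊 ℓ ᵒᵖ) (Ord (s ⊔ suc ℓ ⊔ k) ℓ ℓ) Co Co₁

{-# OPTIONS --safe #-}
-- (f × f)⁻¹(θ) is the kernel of A → B → B / θ, so by the first isomorphism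
-- theorem A / (f × f)⁻¹(θ) is isomorphic to a subalgebra of B / θ.
-- Conversely, the preimage of the equality congruence on A under the inclusion
-- of a subalgebra S is the equality congruence on S, whose quotient is S.
module Submission where

open import Defs
open import Level using (Level)
open import Data.Product.Base using (_×_; ∃; _,_; proj₁; proj₂)
open import Function.Base using (id; _∘_; _on_)
open import Relation.Binary.Morphism.Bundles using (PosetHomomorphism)
import Relation.Binary.Construct.On as On
open import Relation.Unary using (_∈_)

private
  variable
    s ℓ k : Level

module _ {𝕊 : Signature s} where

  quotientMap : (A : Structure 𝕊 ℓ) (θ : Congruence A) → Homomorphism A (A / θ)
  quotientMap A θ = record
    { ⟦_⟧      = id
    ; cong     = Congruence.≈⇒rel θ
    ; preserve = λ _ _ → Structure.refl (A / θ)
    }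

  -- The quotient by this congruence is `A` itself, definitionally, by eta for records. A proof of
  -- `A ∈ contains` therefore serves directly as one for the quotient.
  ≈-congruence : (A : Structure 𝕊 ℓ) → Congruence A
  ≈-congruence A = record
    { rel           = A._≈_
    ; isEquivalence = A.isEquivalence
    ; ≈⇒rel         = id
    ; compatible    = A.interp-cong
    }
    where module A = Structure A

  inclusion : (A : Structure 𝕊 ℓ) (S : Subalgebra A) →
              Homomorphism (subalgebra A S) A
  inclusion A S = record
    { ⟦_⟧      = proj₁
    ; cong     = id
    ; preserve = λ _ _ → Structure.refl A
    }

  module _ {A B : Structure 𝕊 ℓ} (f : Homomorphism A B) where
    private
      module A = Structure A
      module B = Structure B
    open Homomorphism f

    kernel : Congruence A
    kernel = record
      { rel           = B._≈_ on ⟦_⟧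
      ; isEquivalence = On.isEquivalence ⟦_⟧ B.isEquivalence
      ; ≈⇒rel         = cong
      ; compatible    = λ σ {xs} {ys} p →
          B.trans (preserve σ xs)
            (B.trans (B.interp-cong σ p) (B.sym (preserve σ ys)))
      }

    -- Membership carries an actual preimage, so the inverse in `firstIsomorphism` can be read off
    -- without choice. Asking for it only up to `B._≈_` makes the predicate respect equality.
    image : Subalgebra B
    image = record
      { member        = λ b → ∃ λ a → ⟦ a ⟧ B.≈ b
      ; member-resp   = λ x≈y (a , fa≈x) → a , B.trans fa≈x x≈y
      ; member-interp = λ σ xs m →
            A.interp σ (proj₁ ∘ m)
          , B.trans (preserve σ (proj₁ ∘ m)) (B.interp-cong σ (proj₂ ∘ m))
      }

    firstIsomorphism : Category._≅_ (Str 𝕊 ℓ) (A / kernel) (subalgebra B image)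
    firstIsomorphism = record
      { to      = record
        { ⟦_⟧      = λ a → ⟦ a ⟧ , a , B.refl
        ; cong     = id
        ; preserve = preserve
        }
      ; from    = record
        { ⟦_⟧      = λ (_ , a , _) → a
        -- Different preimages of equal elements have equal images, so they are identified modulo
        -- the kernel.
        ; cong     = λ {(_ , _ , fa≈x)} {(_ , _ , fb≈y)} x≈y →
            B.trans fa≈x (B.trans x≈y (B.sym fb≈y))
        ; preserve = λ _ _ → B.refl
        }
      ; to∘from = λ (_ , _ , fa≈x) → fa≈x
      ; from∘to = λ _ → B.refl
      }

  -- Defining it as a kernel makes `firstIsomorphism` apply to its quotient as it stands. Its
  -- relation still unfolds to `rel θ` on the values of `f`, so the description of `Co₁` and the
  -- functor laws for identity and composition hold by `id`.
  preimage : {A B : Structure 𝕊 ℓ} → Homomorphism A B → Congruence B → Congruence A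
  preimage {B = B} f θ = kernel (quotientMap B θ ⊚ f)
    where open Category (Str 𝕊 _) using (_⊚_)

module _ {𝕊 : Signature s} (𝐊 : Class 𝕊 ℓ k) where
  open Class 𝐊
  open Category (Str 𝕊 ℓ) using (_≅_; _⊚_)

  ≅-sym : ∀ {A B} → A ≅ B → B ≅ A
  ≅-sym i = record { to = from ; from = to ; to∘from = from∘to ; from∘to = to∘from }
    where open _≅_ i

  preimage-contains : ClosedUnderSubalgebras 𝐊 → ClosedUnderIsomorphisms 𝐊 →
                      ∀ {A B} (f : Homomorphism A B) (θ : Congruence B) →
                      B / θ ∈ contains → A / preimage f θ ∈ contains
  preimage-contains sub iso {A} {B} f θ B/θ∈𝐊 =
    iso _ _ (≅-sym (firstIsomorphism g)) (sub (B / θ) B/θ∈𝐊 (image g))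
    where
    g : Homomorphism A (B / θ)
    g = quotientMap B θ ⊚ f

  closed⇒functor : ClosedUnderSubalgebras 𝐊 → ClosedUnderIsomorphisms 𝐊 →
                   CoIsFunctor 𝐊
  closed⇒functor sub iso = record
    { Co₁          = λ f → record
      { ⟦_⟧                 = λ (θ , θ∈) →
          preimage f θ , preimage-contains sub iso f θ θ∈
      ; isOrderHomomorphism = record
        { cong = λ (p , q) → (λ r → p r) , (λ r → q r)
        ; mono = λ p r → p r
        }
      }
    ; Co₁-preimage = λ _ _ → id , id
    ; isFunctor    = record
      { resp-≈       = λ {_} {_} {f} {g} f≈g (θ , _) →
          let open Congruence θ
              module E = Structure (_ / θ)
          in  (λ {x} {y} r → E.trans (E.sym (≈⇒rel (f≈g x))) (E.trans r (≈⇒rel (f≈g y))))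
            , (λ {x} {y} r → E.trans (≈⇒rel (f≈g x)) (E.trans r (E.sym (≈⇒rel (f≈g y)))))
      ; identity     = λ _ → id , id
      ; homomorphism = λ _ → id , id
      }
    }

  functor⇒closed : CoIsFunctor 𝐊 → ClosedUnderSubalgebras 𝐊
  functor⇒closed F A A∈𝐊 S =
    -- The functor supplies some congruence with the same pairs as equality on `S`, perhaps as a
    -- different term; extensionality of the class moves membership to the equality congruence,
    -- whose quotient is the subalgebra.
    extensional (subalgebra A S) (proj₁ θ) (≈-congruence (subalgebra A S))
      (Co₁-preimage (inclusion A S) (≈-congruence A , A∈𝐊)) (proj₂ θ)
    where
    open CoIsFunctor F
    θ = PosetHomomorphism.⟦_⟧ (Co₁ (inclusion A S)) (≈-congruence A , A∈𝐊)

proposition3p1 : {s ℓ k : Level} (𝕊 : Signature s) (𝐊 : Class 𝕊 ℓ k) →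
    (ClosedUnderSubalgebras 𝐊 → ClosedUnderIsomorphisms 𝐊 → CoIsFunctor 𝐊)
    × (CoIsFunctor 𝐊 → ClosedUnderSubalgebras 𝐊)
proposition3p1 𝕊 𝐊 = closed⇒functor 𝐊 , functor⇒closed 𝐊
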